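{- Let $k\in\mathbb{N}$ and $n=3k+1$. Any deterministic linear query algorithm that correctly computes the minimum cut weight of all $n$-vertex weighted undirected graphs must make at least $2n-2$ queries in the worst case; i.e. $D_{\mathrm{lin}}(\mathrm{MINCUT}_n)\ge 2n-2$.
   Context: An $n$-vertex weighted undirected graph is $G=(V,w)$ with $w\in\mathbb{R}_{\ge 0}^{\binom n2}$ giving a nonnegative weight to each unordered pair of distinct vertices. For $\emptyset\ne X\subsetneq V$ the cut $\Delta(X)$ consists of pairs with exactly one endpoint in $X$, with weight the sum of their weights. $\mathrm{MINCUT}_n$: given an $n$-vertex weighted graph, output the minimum weight of a cut. In the linear query model the algorithm adaptively chooses vectors $x\in\mathbb{R}^{\binom n2}$ and receives $\langle x,w\rangle$. $D_{\mathrm{lin}}(\mathrm{MINCUT}_n)$ is the minimum, over deterministic linear query algorithms that output the correct answer on every $n$-vertex weighted graph, of the maximum over inputs of the number of queries made. -}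

module Defs where

open import Level using (0ℓ)
open import Data.Nat using (ℕ; zero; suc)
open import Data.Fin using (Fin; _<_)
open import Data.Bool using (Bool; true; false)
open import Data.Product using (Σ; ∃; _×_; _,_)
open import Relation.Nullary using (¬_; yes; no)
open import Relation.Binary.PropositionalEquality using (_≡_; _≢_)
open import Relation.Binary.Structures using (IsTotalOrder)
open import Algebra.Structures using (IsCommutativeRing)
open import Data.Fin.Properties using (_<?_)
open import Data.Bool.Properties using () renaming (_≟_ to _≟B_)

-- The real numbers, axiomatised as a complete ordered field
-- (with propositional equality as the equality of the carrier).
-- Every such structure is isomorphic to ℝ, so quantifying over all of
-- them is the same as speaking about ℝ.

record RealField : Set₁ where
  infixl 6 _+_
  infixl 7 _*_
  infix 4 _≤_
  field
    Carrier : Set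
    _+_ _*_ : Carrier → Carrier → Carrier
    -_      : Carrier → Carrier
    0# 1#   : Carrier
    _≤_     : Carrier → Carrier → Set
    isCommutativeRing : IsCommutativeRing _≡_ _+_ _*_ -_ 0# 1#
    0≢1     : 0# ≢ 1#
    inverse : ∀ x → x ≢ 0# → ∃ λ y → x * y ≡ 1#
    isTotalOrder : IsTotalOrder _≡_ _≤_
    +-mono-≤ : ∀ {x y} z → x ≤ y → x + z ≤ y + z
    *-nonneg : ∀ {x y} → 0# ≤ x → 0# ≤ y → 0# ≤ x * y
    complete : (P : Carrier → Set) → (∃ λ x → P x) →
               (∃ λ b → ∀ x → P x → x ≤ b) →
               ∃ λ s → (∀ x → P x → x ≤ s) ×
                       (∀ b → (∀ x → P x → x ≤ b) → s ≤ b)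

module Graphs (ℝ : RealField) where
  open RealField ℝ

  Σᶠ : ∀ {m} → (Fin m → Carrier) → Carrier
  Σᶠ {zero}  f = 0#
  Σᶠ {suc m} f = f Fin.zero + Σᶠ (λ i → f (Fin.suc i))

  -- A vector in ℝ^(n choose 2), indexed by unordered pairs {i,j};
  -- the pair {i,j} with i < j is stored at entry (i , j); entries with
  -- i ≥ j are irrelevant and are ignored by every definition below.
  PairVec : ℕ → Set
  PairVec n = Fin n → Fin n → Carrier

  Σpairs : ∀ {n} → (Fin n → Fin n → Carrier) → Carrier
  Σpairs f = Σᶠ λ i → Σᶠ λ j → pairTerm i j
    where
    pairTerm : _ → _ → Carrier
    pairTerm i j with i <? j
    ... | yes _ = f i j
    ... | no  _ = 0#

  ⟨_,_⟩ : ∀ {n} → PairVec n → PairVec n → Carrier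
  ⟨ x , w ⟩ = Σpairs λ i j → x i j * w i j

  NonNeg : ∀ {n} → PairVec n → Set
  NonNeg {n} w = ∀ (i j : Fin n) → i < j → 0# ≤ w i j

  Subset : ℕ → Set
  Subset n = Fin n → Bool

  ProperNonempty : ∀ {n} → Subset n → Set
  ProperNonempty X = (∃ λ i → X i ≡ true) × (∃ λ j → X j ≡ false)

  cutWeight : ∀ {n} → PairVec n → Subset n → Carrier
  cutWeight w X = Σpairs λ i j → sep i j
    where
    sep : _ → _ → Carrier
    sep i j with X i ≟B X j
    ... | yes _ = 0#
    ... | no  _ = w i j

  IsMinCut : ∀ {n} → PairVec n → Carrier → Set
  IsMinCut {n} w c =
    (∃ λ X → ProperNonempty {n} X × cutWeight w X ≡ c) ×
    (∀ X → ProperNonempty {n} X → c ≤ cutWeight w X)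

  data LinAlg (n : ℕ) : Set where
    output : Carrier → LinAlg n
    query  : PairVec n → (Carrier → LinAlg n) → LinAlg n

  run : ∀ {n} → LinAlg n → PairVec n → Carrier
  run (output r)  w = r
  run (query x k) w = run (k ⟨ x , w ⟩) w

  cost : ∀ {n} → LinAlg n → PairVec n → ℕ
  cost (output r)  w = 0
  cost (query x k) w = suc (cost (k ⟨ x , w ⟩) w)

  ComputesMinCut : ∀ {n} → LinAlg n → Set
  ComputesMinCut {n} A = ∀ (w : PairVec n) → NonNeg w → IsMinCut w (run A w)

{-# OPTIONS --safe #-}
module Submission where

-- The hard graph consists of k unit-weight copies of K₄ sharing one vertex; it has
-- 6 k = 2 n - 2 edges and minimum cut 3. If fewer than 6 k queries are made on it, some
-- nonzero vector z on its edges is orthogonal to all of them, and by scaling we may take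
-- |z| ≤ 1 everywhere and z = 1 at an edge uv. The weightings 1 - z and 1 + z are then
-- indistinguishable from 1, so all their cuts weigh at least 3. But within the copy of K₄
-- containing uv, the cuts {u} and {v} under 1 - z and {u,v} under 1 + z weigh 8 < 9 in
-- total: each of the four edges crossing {u,v} contributes (1 - z) + (1 + z), and uv
-- itself contributes 2 (1 - 1).

open import Defs
open import Algebra.Bundles using (CommutativeRing)
open import Data.Bool.Base using (Bool; true; false; T; _xor_; if_then_else_)
open import Data.Bool.Properties using (T?; xor-same) renaming (_≟_ to _≟ᵇ_)
open import Data.Empty using (⊥; ⊥-elim)
open import Data.Fin.Base
  using (Fin; zero; suc; _<_; _↑ˡ_; _↑ʳ_; combine; remQuot; quotient; remainder; punchIn; punchOut)
open import Data.Fin.Patterns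
open import Data.Fin.Properties
  using (_≟_; _<?_; any?; all?; toℕ-combine; remQuot-combine; combine-remQuot; punchIn-punchOut)
import Data.Nat.Base as ℕ
open ℕ using (ℕ; zero; suc; z≤n; s≤s)
import Data.Nat.Properties as ℕ
open import Data.Product using (∃; _×_; _,_; proj₁; proj₂; uncurry)
open import Data.Sum.Base using (_⊎_; inj₁; inj₂)
open import Data.Vec.Base using (lookup; []; _∷_)
open import Function.Base using (_∘_; _$_; case_of_)
open import Level using (0ℓ)
open import Relation.Binary.Bundles using (Poset)
open import Relation.Binary.PropositionalEquality
  using (_≡_; _≢_; refl; sym; trans; cong; cong₂; subst; subst₂; module ≡-Reasoning)
import Relation.Binary.Reasoning.PartialOrder as PosetReasoning
open import Relation.Binary.Structures using (IsTotalOrder)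
open import Relation.Nullary using (¬_; Dec; does; yes; no; contradiction)
open import Relation.Nullary.Decidable
  using (¬?; _→-dec_; from-yes; dec-true; dec-false; decidable-stable)

-- Cuts of K₄.

crosses : ∀ {n} → (Fin n → Bool) → Fin n × Fin n → Bool
crosses X (i , j) = X i xor X j

crosses-cong : ∀ {n} {X Y : Fin n → Bool} → (∀ i → X i ≡ Y i) → ∀ p → crosses X p ≡ crosses Y p
crosses-cong X≗Y (i , j) = cong₂ _xor_ (X≗Y i) (X≗Y j)

count : ∀ {m} → (Fin m → Bool) → ℕ
count {zero}  p = 0
count {suc m} p = (if p zero then 1 else 0) ℕ.+ count (p ∘ suc)

module K₄ where

  ends : Fin 6 → Fin 4 × Fin 4
  ends = lookup ((0F , 1F) ∷ (0F , 2F) ∷ (0F , 3F) ∷ (1F , 2F) ∷ (1F , 3F) ∷ (2F , 3F) ∷ [])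

  ends-< : ∀ t → proj₁ (ends t) < proj₂ (ends t)
  ends-< = from-yes (all? λ t → proj₁ (ends t) <? proj₂ (ends t))

  star : Fin 4 → Fin 4 → Bool
  star u i = does (u ≟ i)

  ⁅_⁆ : Fin 6 → Fin 4 → Bool
  ⁅ e ⁆ i = (star (proj₁ (ends e))) i xor (star (proj₂ (ends e))) i

  -- An edge crosses the star of a vertex exactly when that vertex is one of its ends, and K₄ has no
  -- parallel edges.
  crossesBoth⇒≡ : ∀ e t → T (crosses (star (proj₁ (ends e))) (ends t)) →
                  T (crosses (star (proj₂ (ends e))) (ends t)) → t ≡ e
  crossesBoth⇒≡ = from-yes (all? λ e → all? λ t → T? (crosses (star (proj₁ (ends e))) (ends t)) →-dec
    (T? (crosses (star (proj₂ (ends e))) (ends t)) →-dec (t ≟ e)))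

  count-⁅_⁆ : ∀ e → count (crosses ⁅ e ⁆ ∘ ends) ≡ 4
  count-⁅_⁆ = from-yes (all? λ e → count (crosses ⁅ e ⁆ ∘ ends) ℕ.≟ 4)

  -- Crossing is linear over the two-element field in the indicator of the cut; writing `⁅ e ⁆` as a
  -- xor of stars makes use of this. It brings the three cuts of the final count into the form that
  -- `merge` handles.
  crosses-⁅⁆ : ∀ e t → crosses ⁅ e ⁆ (ends t) ≡
    crosses (star (proj₁ (ends e))) (ends t) xor crosses (star (proj₂ (ends e))) (ends t)
  crosses-⁅⁆ = from-yes (all? λ e → all? λ t → crosses ⁅ e ⁆ (ends t) ≟ᵇ
    (crosses (star (proj₁ (ends e))) (ends t) xor crosses (star (proj₂ (ends e))) (ends t)))

  proper-star : ∀ u → (∃ λ i → (star u) i ≡ true) × (∃ λ j → (star u) j ≡ false)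
  proper-star u = (u , dec-true (u ≟ u) refl) , missing u
    where
    missing : ∀ u → ∃ λ j → (star u) j ≡ false
    missing = from-yes (all? λ u → any? λ j → (star u) j ≟ᵇ false)

  proper-⁅_⁆ : ∀ e → (∃ λ i → ⁅ e ⁆ i ≡ true) × (∃ λ j → ⁅ e ⁆ j ≡ false)
  proper-⁅ e ⁆ = from-yes (all? λ e → any? λ i → ⁅ e ⁆ i ≟ᵇ true) e
               , from-yes (all? λ e → any? λ j → ⁅ e ⁆ j ≟ᵇ false) e

  -- Such a cut splits K₄ as 1 + 3 or as 2 + 2, so 3 or 4 edges cross it.
  nonconstant⇒3≤count : ∀ X i → X i ≢ X 0F → 3 ℕ.≤ count (crosses X ∘ ends)
  nonconstant⇒3≤count X i Xi≢X0 =
    go (X 0F) (X 1F) (X 2F) (X 3F) λ e₁ e₂ e₃ → Xi≢X0 (constant e₁ e₂ e₃ i)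
    where
    constant : X 1F ≡ X 0F → X 2F ≡ X 0F → X 3F ≡ X 0F → ∀ i → X i ≡ X 0F
    constant e₁ e₂ e₃ 0F = refl
    constant e₁ e₂ e₃ 1F = e₁
    constant e₁ e₂ e₃ 2F = e₂
    constant e₁ e₂ e₃ 3F = e₃

    -- Once the four values of `X` are variables, every case computes. The result fits the goal by
    -- evaluation, because `X` is only consulted at the four concrete vertices.
    go : ∀ a b c d → (b ≡ a → c ≡ a → d ≡ a → ⊥) →
         3 ℕ.≤ count (crosses (lookup (a ∷ b ∷ c ∷ d ∷ [])) ∘ ends)
    go true  true  true  true  ne = ⊥-elim (ne refl refl refl)
    go true  true  true  false ne = ℕ.m≤m+n 3 _
    go true  true  false true  ne = ℕ.m≤m+n 3 _
    go true  true  false false ne = ℕ.m≤m+n 3 _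
    go true  false true  true  ne = ℕ.m≤m+n 3 _
    go true  false true  false ne = ℕ.m≤m+n 3 _
    go true  false false true  ne = ℕ.m≤m+n 3 _
    go true  false false false ne = ℕ.m≤m+n 3 _
    go false true  true  true  ne = ℕ.m≤m+n 3 _
    go false true  true  false ne = ℕ.m≤m+n 3 _
    go false true  false true  ne = ℕ.m≤m+n 3 _
    go false true  false false ne = ℕ.m≤m+n 3 _
    go false false true  true  ne = ℕ.m≤m+n 3 _
    go false false true  false ne = ℕ.m≤m+n 3 _
    go false false false true  ne = ℕ.m≤m+n 3 _
    go false false false false ne = ⊥-elim (ne refl refl refl)

-- The windmill: copies of K₄ with a common vertex.

-- Vertex 0F of K₄ becomes the hub, shared by all k copies.
module Windmill (k : ℕ) where
  open K₄

  vert : Fin k → Fin 4 → Fin (suc (k ℕ.* 3))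
  vert b zero    = zero
  vert b (suc t) = suc (combine b t)

  collapse : Fin k → Fin k × Fin 3 → Fin 4
  collapse b (b′ , t) = if does (b ≟ b′) then suc t else zero

  -- Folds all copies other than `b` onto the hub. A cut of K₄ pulled back along this map crosses
  -- only edges of copy `b`.
  retract : Fin k → Fin (suc (k ℕ.* 3)) → Fin 4
  retract b zero    = zero
  retract b (suc i) = collapse b (remQuot 3 i)

  copy : Fin k × Fin 6 → Fin (suc (k ℕ.* 3)) × Fin (suc (k ℕ.* 3))
  copy (b , t) = vert b (proj₁ (ends t)) , vert b (proj₂ (ends t))

  edge : Fin (k ℕ.* 6) → Fin (suc (k ℕ.* 3)) × Fin (suc (k ℕ.* 3))
  edge l = copy (remQuot 6 l)

  vert-mono-< : ∀ b {s t} → s < t → vert b s < vert b t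
  vert-mono-< b {zero}  {suc t} _         = s≤s z≤n
  vert-mono-< b {suc s} {suc t} (s≤s s<t) = s≤s $
    subst₂ ℕ._<_ (sym (toℕ-combine b s)) (sym (toℕ-combine b t)) (ℕ.+-monoʳ-< _ s<t)

  -- Vectors are read only at entries (i , j) with i < j, so each edge must be listed with its
  -- smaller end first.
  edge-< : ∀ l → proj₁ (edge l) < proj₂ (edge l)
  edge-< l = vert-mono-< _ (ends-< (remainder {k} 6 l))

  vert-surjective : ∀ i → i ≡ zero ⊎ ∃ λ b → ∃ λ t → vert b t ≡ i
  vert-surjective zero    = inj₁ refl
  vert-surjective (suc i) =
    inj₂ (quotient 3 i , suc (remainder {k} 3 i) , cong suc (combine-remQuot {k} 3 i))

  retract-vert : ∀ b t → retract b (vert b t) ≡ t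
  retract-vert b zero = refl
  retract-vert b (suc t) = trans (cong (collapse b) (remQuot-combine b t))
    (cong (if_then suc t else zero) (dec-true (b ≟ b) refl))

  retract-vert-≢ : ∀ {b b′} → b ≢ b′ → ∀ t → retract b (vert b′ t) ≡ zero
  retract-vert-≢ b≢b′ zero = refl
  retract-vert-≢ {b} {b′} b≢b′ (suc t) = trans (cong (collapse b) (remQuot-combine b′ t))
    (cong (if_then suc t else zero) (dec-false (b ≟ b′) b≢b′))

  crosses-edge : ∀ X b t → crosses X (edge (combine b t)) ≡ crosses (X ∘ vert b) (ends t)
  crosses-edge X b t = cong (crosses X ∘ copy) (remQuot-combine b t)

-- Ordered field arithmetic and a decidable test for zero.

module RealFieldProperties (ℝ : RealField) where
  open RealField ℝ renaming (+-mono-≤ to +-monoˡ-≤)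

  commutativeRing : CommutativeRing 0ℓ 0ℓ
  commutativeRing = record { isCommutativeRing = isCommutativeRing }

  poset : Poset 0ℓ 0ℓ 0ℓ
  poset = record { isPartialOrder = IsTotalOrder.isPartialOrder isTotalOrder }

  open CommutativeRing commutativeRing public using
    ( +-assoc; +-comm; +-identityˡ; +-identityʳ; -‿inverseˡ; -‿inverseʳ
    ; *-assoc; *-comm; *-identityˡ; *-identityʳ; distribˡ; distribʳ; zeroˡ; zeroʳ
    ; ring; semiring; commutativeSemiring; +-monoid; +-group)
  open import Algebra.Properties.Ring ring public
    using (-‿distribˡ-*; -‿distribʳ-*)
  open import Algebra.Properties.Group +-group public
    using () renaming (⁻¹-involutive to -‿involutive; ε⁻¹≈ε to -0≡0)
  open import Algebra.Properties.Monoid.Mult +-monoid public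
    renaming (_×_ to infixr 8 _·_; ×-homo-+ to ·-homo-+; ×-assocˡ to ·-assocˡ)
  open import Algebra.Properties.Semiring.Sum semiring public
  open import Algebra.Solver.Ring.NaturalCoefficients.Default commutativeSemiring
    using (solve; _:+_; _:*_; _:=_; con)

  open IsTotalOrder isTotalOrder public using (total) renaming
    (refl to ≤-refl; trans to ≤-trans; antisym to ≤-antisym)
  module ≤-Reasoning = PosetReasoning poset

  +-mono-≤ : ∀ {x y u v} → x ≤ y → u ≤ v → x + u ≤ y + v
  +-mono-≤ {x} {y} {u} {v} x≤y u≤v = ≤-trans (+-monoˡ-≤ u x≤y)
    (subst₂ _≤_ (+-comm u y) (+-comm v y) (+-monoˡ-≤ y u≤v))

  x+z-z≡x : ∀ x z → x + z + - z ≡ x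
  x+z-z≡x x z = trans (+-assoc x z (- z)) (trans (cong (x +_) (-‿inverseʳ z)) (+-identityʳ x))

  +-cancelʳ-≤ : ∀ {x y} z → x + z ≤ y + z → x ≤ y
  +-cancelʳ-≤ {x} {y} z h = subst₂ _≤_ (x+z-z≡x x z) (x+z-z≡x y z) (+-monoˡ-≤ (- z) h)

  x+y≤x⇒y≤0 : ∀ {x y} → x + y ≤ x → y ≤ 0#
  x+y≤x⇒y≤0 {x} {y} h =
    +-cancelʳ-≤ x (subst₂ _≤_ (+-comm x y) (sym (+-identityˡ x)) h)

  x≤0⇒0≤-x : ∀ {x} → x ≤ 0# → 0# ≤ - x
  x≤0⇒0≤-x {x} h = subst₂ _≤_ (-‿inverseʳ x) (+-identityˡ (- x)) (+-monoˡ-≤ (- x) h)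

  -x*-x≡x*x : ∀ x → - x * - x ≡ x * x
  -x*-x≡x*x x = trans (sym (-‿distribˡ-* x (- x)))
    (trans (cong -_ (sym (-‿distribʳ-* x x))) (-‿involutive (x * x)))

  0≤x*x : ∀ x → 0# ≤ x * x
  0≤x*x x with total 0# x
  ... | inj₁ 0≤x = *-nonneg 0≤x 0≤x
  ... | inj₂ x≤0 = subst (0# ≤_) (-x*-x≡x*x x) (*-nonneg (x≤0⇒0≤-x x≤0) (x≤0⇒0≤-x x≤0))

  0≤1 : 0# ≤ 1#
  0≤1 = subst (0# ≤_) (*-identityˡ 1#) (0≤x*x 1#)

  1≰0 : ¬ (1# ≤ 0#)
  1≰0 1≤0 = 0≢1 (≤-antisym 0≤1 1≤0)

  *-monoʳ-≤ : ∀ {a x y} → 0# ≤ a → x ≤ y → a * x ≤ a * y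
  *-monoʳ-≤ {a} {x} {y} 0≤a x≤y = +-cancelʳ-≤ (a * - x) $ subst₂ _≤_
    (sym (trans (sym (distribˡ a x (- x))) (trans (cong (a *_) (-‿inverseʳ x)) (zeroʳ a))))
    (distribˡ a y (- x))
    (*-nonneg 0≤a (subst (_≤ y + - x) (-‿inverseʳ x) (+-monoˡ-≤ (- x) x≤y)))

  ·-nonneg : ∀ n {x} → 0# ≤ x → 0# ≤ n · x
  ·-nonneg zero    0≤x = ≤-refl
  ·-nonneg (suc n) {x} 0≤x = subst (_≤ x + n · x) (+-identityˡ 0#) (+-mono-≤ 0≤x (·-nonneg n 0≤x))

  ·-monoˡ-≤ : ∀ {m n x} → 0# ≤ x → m ℕ.≤ n → m · x ≤ n · x
  ·-monoˡ-≤ {n = n} 0≤x z≤n = ·-nonneg n 0≤x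
  ·-monoˡ-≤ 0≤x (s≤s m≤n) = +-mono-≤ ≤-refl (·-monoˡ-≤ 0≤x m≤n)

  -- The bound |x| ≤ 1 is expressed through squares. If 1 + x ≤ 0, put u = - (1 + x) ≥ 0; then x² =
  -- (1 + u)² ≥ 1 + u, so x² ≤ 1 forces u ≤ 0.
  x*x≤1⇒0≤1+x : ∀ {x} → x * x ≤ 1# → 0# ≤ 1# + x
  x*x≤1⇒0≤1+x {x} x²≤1 with total 0# (1# + x)
  ... | inj₁ 0≤1+x = 0≤1+x
  ... | inj₂ 1+x≤0 = subst (0# ≤_) (-‿involutive (1# + x)) (x≤0⇒0≤-x u≤0)
    where
    u = - (1# + x)
    0≤u : 0# ≤ u
    0≤u = x≤0⇒0≤-x 1+x≤0
    1+u≡-x : 1# + u ≡ - x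
    1+u≡-x = begin
      1# + u                 ≡⟨ x+z-z≡x (1# + u) x ⟨
      1# + u + x + - x       ≡⟨ cong (_+ - x) (solve 2 (λ u x →
                                  con 1 :+ u :+ x := u :+ (con 1 :+ x)) refl u x) ⟩
      u + (1# + x) + - x     ≡⟨ cong (_+ - x) (-‿inverseˡ (1# + x)) ⟩
      0# + - x               ≡⟨ +-identityˡ (- x) ⟩
      - x                    ∎
      where open ≡-Reasoning
    u≤0 : u ≤ 0#
    u≤0 = x+y≤x⇒y≤0 $ begin
      1# + u                    ≡⟨ trans (+-identityʳ _) (+-identityʳ _) ⟨
      1# + u + 0# + 0#          ≤⟨ +-mono-≤ (+-mono-≤ ≤-refl 0≤u) (0≤x*x u) ⟩
      1# + u + u + u * u        ≡⟨ solve 1 (λ u →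
        con 1 :+ u :+ u :+ u :* u := (con 1 :+ u) :* (con 1 :+ u)) refl u ⟩
      (1# + u) * (1# + u)       ≡⟨ cong₂ _*_ 1+u≡-x 1+u≡-x ⟩
      - x * - x                 ≡⟨ -x*-x≡x*x x ⟩
      x * x                     ≤⟨ x²≤1 ⟩
      1#                        ∎
      where open ≤-Reasoning

  -- For 0 ≤ d ≤ 1, the supremum of the multiples of d that are at most 1 + 1 is at
  -- least 1 when d > 0 and is 0 when d ≡ 0, so comparing it with 1 decides d ≡ 0.
  data Multiple (d : Carrier) : Carrier → Set where
    none : Multiple d 0#
    next : ∀ {z} → Multiple d z → z + d ≤ 1# + 1# → Multiple d (z + d)

  private
    0≤2 : 0# ≤ 1# + 1#
    0≤2 = subst (_≤ 1# + 1#) (+-identityˡ 0#) (+-mono-≤ 0≤1 0≤1)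

    multiple≤2 : ∀ {d} z → Multiple d z → z ≤ 1# + 1#
    multiple≤2 _ none       = 0≤2
    multiple≤2 _ (next _ h) = h

    multiple-of-0 : ∀ {z} → Multiple 0# z → z ≤ 0#
    multiple-of-0 none       = ≤-refl
    multiple-of-0 (next m _) = subst (_≤ 0#) (sym (+-identityʳ _)) (multiple-of-0 m)

  nonneg-≟0 : ∀ {d} → 0# ≤ d → Dec (d ≡ 0#)
  nonneg-≟0 {d} 0≤d with complete (Multiple d) (0# , none) (1# + 1# , multiple≤2)
  ... | s , upper , least with total s 1# | total d 1#
  ...   | inj₂ 1≤s | _        = no λ { refl → 1≰0 (≤-trans 1≤s (least 0# λ z → multiple-of-0)) }
  ...   | inj₁ s≤1 | inj₂ 1≤d = no λ { refl → 1≰0 1≤d }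
  ...   | inj₁ s≤1 | inj₁ d≤1 = yes (≤-antisym (x+y≤x⇒y≤0 s+d≤s) 0≤d)
    where
    -- Multiples are at most s ≤ 1 and d ≤ 1, so one more step stays within the cap 2. Hence s - d
    -- is an upper bound too, and leastness gives s ≤ s - d.
    z+d≤s : ∀ {z} → Multiple d z → z + d ≤ s
    z+d≤s {z} m = upper (z + d) (next m (+-mono-≤ (≤-trans (upper z m) s≤1) d≤1))
    s+d≤s : s + d ≤ s
    s+d≤s = subst (s + d ≤_) (trans (+-assoc s (- d) d) (trans (cong (s +_) (-‿inverseˡ d)) (+-identityʳ s)))
      (+-monoˡ-≤ d (least (s + - d) λ z m →
        subst (_≤ s + - d) (x+z-z≡x z d) (+-monoˡ-≤ (- d) (z+d≤s m))))

  -- Gaussian elimination needs this test to search a column for a pivot; totality of the order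
  -- reduces it to nonnegative elements.
  _≟0 : ∀ x → Dec (x ≡ 0#)
  x ≟0 with total 0# x
  ... | inj₁ 0≤x = nonneg-≟0 0≤x
  ... | inj₂ x≤0 with nonneg-≟0 (x≤0⇒0≤-x x≤0)
  ...   | yes -x≡0 = yes (trans (sym (-‿involutive x)) (trans (cong -_ -x≡0) -0≡0))
  ...   | no  -x≢0 = no λ { refl → -x≢0 -0≡0 }

  -- Conditional terms and finite sums

  infix 5 _when_
  _when_ : Carrier → Bool → Carrier
  x when true  = x
  x when false = 0#

  *-when : ∀ x y b → x * (y when b) ≡ (x * y when b)
  *-when x y true  = refl
  *-when x y false = zeroʳ x

  when-nonneg : ∀ {x} b → 0# ≤ x → 0# ≤ (x when b)
  when-nonneg true  0≤x = 0≤x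
  when-nonneg false _   = ≤-refl

  sum-zero : ∀ {m} {f : Fin m → Carrier} → (∀ i → f i ≡ 0#) → sum f ≡ 0#
  sum-zero {m} f≡0 = trans (sum-cong-≗ f≡0) (sum-replicate-zero m)

  sum-when : ∀ {m} (f : Fin m → Carrier) b → (sum f when b) ≡ sum (λ i → f i when b)
  sum-when f true  = refl
  sum-when {m} f false = sym (sum-zero {m} λ _ → refl)

  sum-select : ∀ {m} (a : Fin m) (f : Fin m → Carrier) →
               sum (λ i → f i when does (a ≟ i)) ≡ f a
  sum-select {suc m} zero    f = trans (cong (f zero +_) (sum-zero {m} λ _ → refl)) (+-identityʳ (f zero))
  sum-select (suc a) f = trans (+-identityˡ _) (sum-select a (f ∘ suc))

  sum-nonneg : ∀ {m} {f : Fin m → Carrier} → (∀ i → 0# ≤ f i) → 0# ≤ sum f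
  sum-nonneg {zero}      0≤f = ≤-refl
  sum-nonneg {suc m} {f} 0≤f = subst (_≤ sum f) (+-identityˡ 0#) (+-mono-≤ (0≤f zero) (sum-nonneg (0≤f ∘ suc)))

  term≤sum : ∀ {m} {f : Fin m → Carrier} → (∀ i → 0# ≤ f i) → ∀ i → f i ≤ sum f
  term≤sum {suc m} {f} 0≤f zero    =
    subst (_≤ sum f) (+-identityʳ (f zero)) (+-mono-≤ ≤-refl (sum-nonneg (0≤f ∘ suc)))
  term≤sum {suc m} {f} 0≤f (suc i) =
    subst (_≤ sum f) (+-identityˡ (f (suc i))) (+-mono-≤ (0≤f zero) (term≤sum (0≤f ∘ suc) i))

  sum-count : ∀ {m} x (p : Fin m → Bool) → sum (λ i → x when p i) ≡ count p · x
  sum-count {zero}  x p = refl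
  sum-count {suc m} x p with p zero
  ... | true  = cong (x +_) (sum-count x (p ∘ suc))
  ... | false = trans (+-identityˡ _) (sum-count x (p ∘ suc))

  sum-++ : ∀ m {n} (f : Fin (m ℕ.+ n) → Carrier) →
           sum f ≡ sum (λ i → f (i ↑ˡ n)) + sum (λ j → f (m ↑ʳ j))
  sum-++ zero    f = sym (+-identityˡ (sum f))
  sum-++ (suc m) f = trans (cong (f zero +_) (sum-++ m (f ∘ suc))) (sym (+-assoc _ _ _))

  sum-combine : ∀ {m n} (f : Fin (m ℕ.* n) → Carrier) →
                sum f ≡ sum λ i → sum λ j → f (combine {m} {n} i j)
  sum-combine {zero}      f = refl
  sum-combine {suc m} {n} f = trans (sum-++ n f)
    (cong (sum (λ j → f (j ↑ˡ m ℕ.* n)) +_) (sum-combine {m} {n} (λ i → f (n ↑ʳ i))))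

  sum-*-scale : ∀ {m} c (f z : Fin m → Carrier) →
                sum (λ j → f j * (c * z j)) ≡ c * sum (λ j → f j * z j)
  sum-*-scale c f z = trans
    (sum-cong-≗ λ j → solve 3 (λ f c z → f :* (c :* z) := c :* (f :* z)) refl (f j) c (z j))
    (sym (*-distribˡ-sum c λ j → f j * z j))

  -- Linear algebra

  -- Gaussian elimination. If the first column vanishes, the first unit vector is a solution.
  -- Otherwise a pivot row `p` eliminates the first unknown from the other rows, and both dimensions
  -- drop by one.
  underdetermined : ∀ {q m} → q ℕ.< m → (M : Fin q → Fin m → Carrier) →
    ∃ λ (z : Fin m → Carrier) → (∃ λ j → z j ≢ 0#) × (∀ i → sum (λ j → M i j * z j) ≡ 0#)
  underdetermined {q} {suc m} (s≤s q≤m) M with any? (λ i → ¬? (M i zero ≟0))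
  ... | no column≡0 = e₀ , (zero , λ e → 0≢1 (sym e)) , λ i → trans
          (cong₂ _+_ (trans (cong (_* 1#) (M₀≡0 i)) (zeroˡ 1#)) (sum-zero λ j → zeroʳ (M i (suc j))))
          (+-identityˡ 0#)
    where
    e₀ : Fin (suc m) → Carrier
    e₀ zero    = 1#
    e₀ (suc _) = 0#
    M₀≡0 : ∀ i → M i zero ≡ 0#
    M₀≡0 i = decidable-stable (M i zero ≟0) λ ne → column≡0 (i , ne)
  underdetermined {suc q} {suc m} (s≤s q<m) M | yes (p , pivot≢0) =
    z , (suc (proj₁ z′≢0) , proj₂ z′≢0) , λ i → solves i (p ≟ i)
    where
    inv = proj₁ (inverse (M p zero) pivot≢0)
    -- The multiple of row `p` that clears the first entry of the other row.
    coeff : Fin q → Carrier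
    coeff i = - (M (punchIn p i) zero * inv)
    M′ : Fin q → Fin m → Carrier
    M′ i j = M (punchIn p i) (suc j) + coeff i * M p (suc j)
    rec = underdetermined q<m M′
    z′ = proj₁ rec
    z′≢0 = proj₁ (proj₂ rec)
    row : Fin (suc q) → Carrier
    row i = sum λ j → M i (suc j) * z′ j
    z : Fin (suc m) → Carrier
    -- Back substitution: the pivot equation solved for the first unknown.
    z zero    = - (inv * row p)
    z (suc j) = z′ j
    M′-solved : ∀ i → row (punchIn p i) + coeff i * row p ≡ 0#
    M′-solved i = begin
      row (punchIn p i) + coeff i * row p
        ≡⟨ cong (row (punchIn p i) +_) (*-distribˡ-sum (coeff i) λ j → M p (suc j) * z′ j) ⟩
      row (punchIn p i) + sum (λ j → coeff i * (M p (suc j) * z′ j))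
        ≡⟨ ∑-distrib-+ (λ j → M (punchIn p i) (suc j) * z′ j) _ ⟨
      sum (λ j → M (punchIn p i) (suc j) * z′ j + coeff i * (M p (suc j) * z′ j))
        ≡⟨ sum-cong-≗ (λ j → solve 4 (λ a b c d → a :* d :+ b :* (c :* d) := (a :+ b :* c) :* d) refl
             (M (punchIn p i) (suc j)) (coeff i) (M p (suc j)) (z′ j)) ⟩
      sum (λ j → M′ i j * z′ j)
        ≡⟨ proj₂ (proj₂ rec) i ⟩
      0# ∎
      where open ≡-Reasoning
    move : ∀ a → a * - (inv * row p) ≡ - (a * inv) * row p
    move a = trans (sym (-‿distribʳ-* a (inv * row p)))
      (trans (cong -_ (sym (*-assoc a inv (row p)))) (-‿distribˡ-* (a * inv) (row p)))
    solves : ∀ i → Dec (p ≡ i) → M i zero * - (inv * row p) + row i ≡ 0#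
    solves i (yes refl) = trans (cong (_+ row p) (begin
      M p zero * - (inv * row p)    ≡⟨ -‿distribʳ-* (M p zero) (inv * row p) ⟨
      - (M p zero * (inv * row p))  ≡⟨ cong -_ (*-assoc (M p zero) inv (row p)) ⟨
      - (M p zero * inv * row p)    ≡⟨ cong (λ a → - (a * row p)) (proj₂ (inverse (M p zero) pivot≢0)) ⟩
      - (1# * row p)                ≡⟨ cong -_ (*-identityˡ (row p)) ⟩
      - row p                       ∎)) (-‿inverseˡ (row p))
      where open ≡-Reasoning
    -- Away from the pivot, the first term equals `coeff` times `row p`, which turns the equation
    -- into one of the reduced system.
    solves i (no p≢i) = subst (λ i → M i zero * - (inv * row p) + row i ≡ 0#) (punchIn-punchOut p≢i)
      (trans (+-comm _ _) (trans (cong (row i′ +_) (move (M i′ zero))) (M′-solved _)))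
      where i′ = punchIn p (punchOut p≢i)

  argmax : ∀ {m} (f : Fin (suc m) → Carrier) → ∃ λ j → ∀ i → f i ≤ f j
  argmax {zero}  f = zero , λ { zero → ≤-refl }
  argmax {suc m} f with argmax (f ∘ suc)
  ... | j , max with total (f zero) (f (suc j))
  ...   | inj₁ f₀≤ = suc j , λ { zero → f₀≤ ; (suc i) → max i }
  ...   | inj₂ ≤f₀ = zero , λ { zero → ≤-refl ; (suc i) → ≤-trans (max i) ≤f₀ }

  -- Divide by an entry whose square is largest. Squares take the place of absolute values.
  normalise : ∀ {m} (z : Fin m → Carrier) → (∃ λ j → z j ≢ 0#) →
    ∃ λ c → (∀ j → c * z j * (c * z j) ≤ 1#) × (∃ λ j → c * z j ≡ 1#)
  normalise {suc m} z (i , zᵢ≢0) = c , bound , j , cz≡1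
    where
    j = proj₁ (argmax λ i → z i * z i)
    max = proj₂ (argmax λ i → z i * z i)
    zⱼ≢0 : z j ≢ 0#
    -- If the largest square were zero, every square would be zero, and a field has no nonzero
    -- element with square zero.
    zⱼ≢0 zⱼ≡0 = zᵢ≢0 (square≡0 (≤-antisym
      (subst (z i * z i ≤_) (trans (cong (λ x → x * x) zⱼ≡0) (zeroʳ 0#)) (max i)) (0≤x*x (z i))))
      where
      square≡0 : ∀ {x} → x * x ≡ 0# → x ≡ 0#
      square≡0 {x} x²≡0 = decidable-stable (x ≟0) λ x≢0 →
        let y , xy≡1 = inverse x x≢0 in x≢0 $ begin
          x            ≡⟨ *-identityʳ x ⟨
          x * 1#       ≡⟨ cong (x *_) xy≡1 ⟨
          x * (x * y)  ≡⟨ *-assoc x x y ⟨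
          x * x * y    ≡⟨ cong (_* y) x²≡0 ⟩
          0# * y       ≡⟨ zeroˡ y ⟩
          0#           ∎
        where open ≡-Reasoning
    c = proj₁ (inverse (z j) zⱼ≢0)
    cz≡1 : c * z j ≡ 1#
    cz≡1 = trans (*-comm c (z j)) (proj₂ (inverse (z j) zⱼ≢0))
    square-* : ∀ x → c * c * (x * x) ≡ c * x * (c * x)
    square-* x = solve 2 (λ c x → c :* c :* (x :* x) := c :* x :* (c :* x)) refl c x
    bound : ∀ i → c * z i * (c * z i) ≤ 1#
    bound i = subst₂ _≤_ (square-* (z i))
      (trans (square-* (z j)) (trans (cong₂ _*_ cz≡1 cz≡1) (*-identityˡ 1#)))
      (*-monoʳ-≤ (0≤x*x c) (max i))

-- Cut weights and queries on graphs given by edge lists; transcripts of algorithms.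

module GraphProperties (ℝ : RealField) where
  open RealField ℝ
  open RealFieldProperties ℝ
  open Graphs ℝ

  Σᶠ≡sum : ∀ {m} (f : Fin m → Carrier) → Σᶠ f ≡ sum f
  Σᶠ≡sum {zero}  f = refl
  Σᶠ≡sum {suc m} f = cong (f zero +_) (Σᶠ≡sum (f ∘ suc))

  Σᶠ²≡sum² : ∀ {m n} {f g : Fin m → Fin n → Carrier} → (∀ i j → f i j ≡ g i j) →
             Σᶠ (λ i → Σᶠ (f i)) ≡ sum λ i → sum (g i)
  Σᶠ²≡sum² {f = f} f≡g =
    trans (Σᶠ≡sum (λ i → Σᶠ (f i))) (sum-cong-≗ λ i → trans (Σᶠ≡sum (f i)) (sum-cong-≗ (f≡g i)))

  -- The mutual block lets unification fill in the term of Σpairs, which is local to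
  -- its definition and has no name.
  mutual
    Σpairs≡sum : ∀ {n} (f : Fin n → Fin n → Carrier) →
                 Σpairs f ≡ sum λ i → sum λ j → f i j when does (i <? j)
    Σpairs≡sum f = Σᶠ²≡sum² (pairTerm≡when f)

    pairTerm≡when : ∀ {n} (f : Fin n → Fin n → Carrier) i j → _ ≡ (f i j when does (i <? j))
    pairTerm≡when f i j with i <? j
    ... | yes i<j = cong (f i j when_) (sym (dec-true (i <? j) i<j))
    ... | no  i≮j = cong (f i j when_) (sym (dec-false (i <? j) i≮j))

  Σpairs-cong : ∀ {n} {f g : Fin n → Fin n → Carrier} → (∀ i j → f i j ≡ g i j) →
                Σpairs f ≡ Σpairs g
  Σpairs-cong {f = f} {g} f≡g = trans (Σpairs≡sum f) (trans
    (sum-cong-≗ λ i → sum-cong-≗ λ j → cong (_when does (i <? j)) (f≡g i j))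
    (sym (Σpairs≡sum g)))

  mutual
    -- A cut weight is the inner product with the indicator of the cut, so a formula for queries
    -- also serves for cuts. The local `sep` is again reached by unification.
    cutWeight≡⟨⟩ : ∀ {n} (w : PairVec n) X →
                   cutWeight w X ≡ ⟨ (λ i j → 1# when crosses X (i , j)) , w ⟩
    cutWeight≡⟨⟩ w X = Σpairs-cong (sep≡* w X)

    sep≡* : ∀ {n} (w : PairVec n) X i j → _ ≡ (1# when crosses X (i , j)) * w i j
    sep≡* w X i j with X i ≟ᵇ X j
    ... | yes e = sym (trans (cong (_* w i j) (cong (1# when_) (trans (cong (_xor X j) e) (xor-same (X j)))))
                             (zeroˡ (w i j)))
    ... | no ne = sym (trans (cong (_* w i j) (cong (1# when_) (≢⇒xor ne))) (*-identityˡ (w i j)))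
      where
      ≢⇒xor : ∀ {p q} → p ≢ q → p xor q ≡ true
      ≢⇒xor {true}  {true}  p≢q = contradiction refl p≢q
      ≢⇒xor {true}  {false} p≢q = refl
      ≢⇒xor {false} {true}  p≢q = refl
      ≢⇒xor {false} {false} p≢q = contradiction refl p≢q

  -- Edge `l` adds `y l` at the pair of its ends. Keeping the sum over edges explicit lets inner
  -- products be computed by exchanging sums.
  fromEdges : ∀ {m n} → (Fin m → Fin n × Fin n) → (Fin m → Carrier) → PairVec n
  fromEdges e y i j =
    sum λ l → (y l when does (proj₂ (e l) ≟ j)) when does (proj₁ (e l) ≟ i)

  fromEdges-nonneg : ∀ {m n} (e : Fin m → Fin n × Fin n) {y} →
                     (∀ l → 0# ≤ y l) → NonNeg (fromEdges e y)
  fromEdges-nonneg e 0≤y i j _ =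
    sum-nonneg λ l → when-nonneg (does (proj₁ (e l) ≟ i)) (when-nonneg (does (proj₂ (e l) ≟ j)) (0≤y l))

  -- Move the sum over edges outermost; for a fixed edge, the two inner sums then collapse to the
  -- pair of its ends.
  ⟨⟩-fromEdges : ∀ {m n} (x : PairVec n) (e : Fin m → Fin n × Fin n) y →
                 (∀ l → proj₁ (e l) < proj₂ (e l)) →
                 ⟨ x , fromEdges e y ⟩ ≡ sum λ l → uncurry x (e l) * y l
  ⟨⟩-fromEdges {m} {n} x e y e-< = begin
    ⟨ x , fromEdges e y ⟩
      ≡⟨ Σpairs≡sum (λ i j → x i j * fromEdges e y i j) ⟩
    (sum λ i → sum λ j → x i j * fromEdges e y i j when does (i <? j))
      ≡⟨ sum-cong-≗ (λ i → sum-cong-≗ λ j → expand i j) ⟩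
    (sum λ i → sum λ j → sum λ l → (F l i j when does (b l ≟ j)) when does (a l ≟ i))
      ≡⟨ sum-cong-≗ (λ i → ∑-comm λ j l → (F l i j when does (b l ≟ j)) when does (a l ≟ i)) ⟩
    (sum λ i → sum λ l → sum λ j → (F l i j when does (b l ≟ j)) when does (a l ≟ i))
      ≡⟨ ∑-comm (λ i l → sum λ j → (F l i j when does (b l ≟ j)) when does (a l ≟ i)) ⟩
    (sum λ l → sum λ i → sum λ j → (F l i j when does (b l ≟ j)) when does (a l ≟ i))
      ≡⟨ sum-cong-≗ select ⟩
    (sum λ l → x (a l) (b l) * y l) ∎
    where
    open ≡-Reasoning
    a b : Fin m → Fin n
    a = proj₁ ∘ e
    b = proj₂ ∘ e
    F : Fin m → Fin n → Fin n → Carrier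
    F l i j = x i j * y l when does (i <? j)

    incident : Fin n → Fin n → Fin m → Carrier
    incident i j l = (y l when does (b l ≟ j)) when does (a l ≟ i)

    *-when² : ∀ x y p q r →
      (x * ((y when q) when p) when r) ≡ (((x * y when r) when q) when p)
    *-when² x y true  true  r     = refl
    *-when² x y true  false true  = zeroʳ x
    *-when² x y true  false false = refl
    *-when² x y false q     true  = zeroʳ x
    *-when² x y false q     false = refl

    expand : ∀ i j → (x i j * fromEdges e y i j when does (i <? j)) ≡
      sum λ l → (F l i j when does (b l ≟ j)) when does (a l ≟ i)
    expand i j = trans (cong (_when does (i <? j)) (*-distribˡ-sum (x i j) (incident i j)))
      (trans (sum-when (λ l → x i j * incident i j l) (does (i <? j)))
        (sum-cong-≗ λ l → *-when² (x i j) (y l) (does (a l ≟ i)) (does (b l ≟ j)) (does (i <? j))))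

    select : ∀ l → (sum λ i → sum λ j → (F l i j when does (b l ≟ j)) when does (a l ≟ i)) ≡
             x (a l) (b l) * y l
    select l = begin
      (sum λ i → sum λ j → (F l i j when does (b l ≟ j)) when does (a l ≟ i))
        ≡⟨ sum-cong-≗ (λ i → sym (sum-when (λ j → F l i j when does (b l ≟ j)) (does (a l ≟ i)))) ⟩
      (sum λ i → (sum λ j → F l i j when does (b l ≟ j)) when does (a l ≟ i))
        ≡⟨ sum-select (a l) _ ⟩
      (sum λ j → F l (a l) j when does (b l ≟ j))
        ≡⟨ sum-select (b l) _ ⟩
      F l (a l) (b l)
        -- The ends are in increasing order, so this pair is among those that `Σpairs` counts.
        ≡⟨ cong (x (a l) (b l) * y l when_) (dec-true (a l <? b l) (e-< l)) ⟩
      x (a l) (b l) * y l ∎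

  cutWeight-fromEdges : ∀ {m n} (e : Fin m → Fin n × Fin n) y X →
                        (∀ l → proj₁ (e l) < proj₂ (e l)) →
                        cutWeight (fromEdges e y) X ≡ sum λ l → y l when crosses X (e l)
  cutWeight-fromEdges e y X e-< = trans (cutWeight≡⟨⟩ (fromEdges e y) X)
    (trans (⟨⟩-fromEdges _ e y e-<) (sum-cong-≗ λ l → 1-when-* (y l) (crosses X (e l))))
    where
    1-when-* : ∀ x p → (1# when p) * x ≡ (x when p)
    1-when-* x true  = *-identityˡ x
    1-when-* x false = zeroˡ x

  queries : ∀ {n} (A : LinAlg n) w → Fin (cost A w) → PairVec n
  queries (query x k) w zero    = x
  queries (query x k) w (suc i) = queries (k ⟨ x , w ⟩) w i

  -- The queries are adaptive, but equal answers lead into the same branch. Agreement on the queries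
  -- asked on `w` therefore fixes the whole run.
  run-cong : ∀ {n} (A : LinAlg n) w {w′} →
             (∀ i → ⟨ queries A w i , w′ ⟩ ≡ ⟨ queries A w i , w ⟩) → run A w′ ≡ run A w
  run-cong (output r)  w        same = refl
  run-cong (query x k) w {w′} same = trans (cong (λ r → run (k r) w′) (same zero))
    (run-cong (k ⟨ x , w ⟩) w (same ∘ suc))

-- The adversary argument on the windmill.

module LowerBound (ℝ : RealField) (k : ℕ) where
  open RealField ℝ hiding (+-mono-≤)
  open RealFieldProperties ℝ
  open GraphProperties ℝ
  open Graphs ℝ
  open K₄
  open Windmill k
  open import Algebra.Solver.Ring.NaturalCoefficients.Default commutativeSemiring
    using (solve; _:+_; _:=_)

  windmill : (Fin (k ℕ.* 6) → Carrier) → PairVec (suc (k ℕ.* 3))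
  windmill = fromEdges edge

  cutWeight-windmill : ∀ y X → cutWeight (windmill y) X ≡
    sum λ b → sum λ t → y (combine {k} b t) when crosses (X ∘ vert b) (ends t)
  cutWeight-windmill y X = trans (cutWeight-fromEdges edge y X edge-<) (trans
    (sum-combine {k} {6} λ l → y l when crosses X (edge l))
    (sum-cong-≗ λ b → sum-cong-≗ λ t → cong (y (combine {k} b t) when_) (crosses-edge X b t)))

  -- Copy `b` sees `X` itself, while any other copy lies entirely on the side of the hub and
  -- contributes nothing.
  cutWeight-retract : ∀ y b X → cutWeight (windmill y) (X ∘ retract b) ≡
    sum λ t → y (combine {k} b t) when crosses X (ends t)
  cutWeight-retract y b X = trans (cutWeight-windmill y (X ∘ retract b))
    (trans (sum-cong-≗ λ b′ → local b′ (b ≟ b′)) (sum-select b _))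
    where
    local : ∀ b′ (b≟b′ : Dec (b ≡ b′)) →
      (sum λ t → y (combine {k} b′ t) when crosses (X ∘ retract b ∘ vert b′) (ends t)) ≡
      ((sum λ t → y (combine {k} b′ t) when crosses X (ends t)) when does b≟b′)
    local b′ (yes refl) = sum-cong-≗ λ t → cong (y (combine {k} b t) when_)
      (crosses-cong (λ i → cong X (retract-vert b i)) (ends t))
    local b′ (no b≢b′) = sum-zero λ t → cong (y (combine {k} b′ t) when_) (trans
      (crosses-cong (λ i → cong X (retract-vert-≢ b≢b′ i)) (ends t))
      (xor-same (X zero)))

  -- Some vertex is separated from the hub, and the copy of K₄ containing it already contributes 3.
  unit-cut : ∀ X → ProperNonempty X → 3 · 1# ≤ cutWeight (windmill λ _ → 1#) X
  unit-cut X ((i , Xi) , (j , Xj)) = separated (X zero ≟ᵇ true)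
    where
    go : ∀ i → X i ≢ X zero → 3 · 1# ≤ cutWeight (windmill λ _ → 1#) X
    go i Xi≢ with vert-surjective i
    ... | inj₁ refl = contradiction refl Xi≢
    ... | inj₂ (b , t , refl) = begin
      3 · 1#
        ≤⟨ ·-monoˡ-≤ 0≤1 (nonconstant⇒3≤count (X ∘ vert b) t Xi≢) ⟩
      count (crosses (X ∘ vert b) ∘ ends) · 1#
        ≡⟨ sum-count 1# (crosses (X ∘ vert b) ∘ ends) ⟨
      (sum λ t → 1# when crosses (X ∘ vert b) (ends t))
        ≤⟨ term≤sum (λ b → sum-nonneg λ t → when-nonneg (crosses (X ∘ vert b) (ends t)) 0≤1) b ⟩
      (sum λ b → sum λ t → 1# when crosses (X ∘ vert b) (ends t))
        ≡⟨ cutWeight-windmill (λ _ → 1#) X ⟨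
      cutWeight (windmill λ _ → 1#) X ∎
      where open ≤-Reasoning
    -- The hub lies on one side, so one of the two witnesses of properness lies on the other.
    separated : Dec (X zero ≡ true) → 3 · 1# ≤ cutWeight (windmill λ _ → 1#) X
    separated (yes X0) = go j λ e → case trans (sym Xj) (trans e X0) of λ ()
    separated (no ¬X0) = go i λ e → ¬X0 (trans (sym e) Xi)

  proper-retract : ∀ b {X} → ProperNonempty X → ProperNonempty (X ∘ retract b)
  proper-retract b {X} ((i , Xi) , (j , Xj)) =
    (vert b i , trans (cong X (retract-vert b i)) Xi) , (vert b j , trans (cong X (retract-vert b j)) Xj)

  module _ (A : LinAlg (suc (k ℕ.* 3))) (correct : ComputesMinCut A) where

    unit : PairVec (suc (k ℕ.* 3))
    unit = windmill λ _ → 1#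

    unit-nonneg : NonNeg unit
    unit-nonneg = fromEdges-nonneg edge λ _ → 0≤1

    -- A correct output is attained by some proper cut, and `unit-cut` bounds that cut.
    3≤run-unit : 3 · 1# ≤ run A unit
    3≤run-unit with correct unit unit-nonneg
    ... | (X , proper , cut≡run) , _ = subst (3 · 1# ≤_) cut≡run (unit-cut X proper)

    module _ (z : Fin (k ℕ.* 6) → Carrier)
             (z⊥ : ∀ i → sum (λ l → uncurry (queries A unit i) (edge l) * z l) ≡ 0#) where

      -- By linearity the perturbation adds `c` times zero to each answer, so the run is the one on
      -- `unit`.
      indistinguishable : ∀ c → run A (windmill λ l → 1# + c * z l) ≡ run A unit
      indistinguishable c = run-cong A unit λ i → let x = queries A unit i in begin
        ⟨ x , (windmill λ l → 1# + c * z l) ⟩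
          ≡⟨ ⟨⟩-fromEdges x edge _ edge-< ⟩
        (sum λ l → uncurry x (edge l) * (1# + c * z l))
          ≡⟨ sum-cong-≗ (λ l → distribˡ (uncurry x (edge l)) 1# (c * z l)) ⟩
        (sum λ l → uncurry x (edge l) * 1# + uncurry x (edge l) * (c * z l))
          ≡⟨ ∑-distrib-+ (λ l → uncurry x (edge l) * 1#) _ ⟩
        (sum λ l → uncurry x (edge l) * 1#) + (sum λ l → uncurry x (edge l) * (c * z l))
          ≡⟨ cong ((sum λ l → uncurry x (edge l) * 1#) +_)
               (trans (sum-*-scale c _ z) (trans (cong (c *_) (z⊥ i)) (zeroʳ c))) ⟩
        (sum λ l → uncurry x (edge l) * 1#) + 0#
          ≡⟨ +-identityʳ _ ⟩
        (sum λ l → uncurry x (edge l) * 1#)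
          ≡⟨ ⟨⟩-fromEdges x edge _ edge-< ⟨
        ⟨ x , unit ⟩ ∎
        where open ≡-Reasoning

      -- Here correctness is used in the other direction: the common output, at least 3, is a lower
      -- bound for every cut of the perturbed graph, in particular for those pulled back from copy
      -- `b`.
      cut≥3 : ∀ c → (∀ l → 0# ≤ 1# + c * z l) → ∀ b X → ProperNonempty X →
        3 · 1# ≤ sum λ t → 1# + c * z (combine {k} b t) when crosses X (ends t)
      cut≥3 c nonneg b X proper = begin
        3 · 1#
          ≤⟨ 3≤run-unit ⟩
        run A unit
          ≡⟨ indistinguishable c ⟨
        run A w
          ≤⟨ proj₂ (correct w (fromEdges-nonneg edge nonneg)) _ (proper-retract b proper) ⟩
        cutWeight w (X ∘ retract b)
          ≡⟨ cutWeight-retract _ b X ⟩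
        (sum λ t → 1# + c * z (combine {k} b t) when crosses X (ends t)) ∎
        where
        open ≤-Reasoning
        w = windmill λ l → 1# + c * z l

    -- p, q: whether an edge of weight x = 1 - z or y = 1 + z meets u, v.
    merge : ∀ p q {x y} → (T p → T q → x ≡ 0#) → x + y ≡ 1# + 1# →
            (x when p) + (x when q) + (y when (p xor q)) ≡ (1# + 1# when (p xor q))
    merge true  true  {x} {y} x≡0 _ =
      trans (cong₂ (λ a b → a + b + 0#) (x≡0 _ _) (x≡0 _ _)) (trans (+-identityʳ _) (+-identityʳ 0#))
    merge true  false {x} {y} _ x+y = trans (cong (_+ y) (+-identityʳ x)) x+y
    merge false true  {x} {y} _ x+y = trans (cong (_+ y) (+-identityˡ x)) x+y
    merge false false _ _ = trans (+-identityʳ _) (+-identityʳ 0#)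

    9≰8 : ¬ (3 · 1# + 3 · 1# + 3 · 1# ≤ 4 · (1# + 1#))
    -- `9 · 1#` unfolds to `1# + 8 · 1#`, so cancelling 8 leaves 1 ≤ 0.
    9≰8 9≤8 = 1≰0 (+-cancelʳ-≤ (8 · 1#) (subst₂ _≤_ sum≡9 4·2≡8 9≤8))
      where
      sum≡9 : 3 · 1# + 3 · 1# + 3 · 1# ≡ 9 · 1#
      sum≡9 = trans (cong (_+ 3 · 1#) (sym (·-homo-+ 1# 3 3))) (sym (·-homo-+ 1# 6 3))
      4·2≡8 : 4 · (1# + 1#) ≡ 0# + 8 · 1#
      4·2≡8 = trans (cong (λ x → 4 · (1# + x)) (sym (+-identityʳ 1#)))
        (trans (·-assocˡ 1# 4 2) (sym (+-identityˡ (8 · 1#))))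

    -- The three cuts are added edge by edge. The four edges crossing `⁅ e ⁆` give 2 each; `e` gives
    -- 0 by the choice of scale, and the opposite edge crosses none of the cuts.
    orthogonal⇒zero : ∀ z → (∀ i → sum (λ l → uncurry (queries A unit i) (edge l) * z l) ≡ 0#) →
                      ¬ (∃ λ l → z l ≢ 0#)
    orthogonal⇒zero z z⊥ z≢0 = 9≰8 $ begin
      3 · 1# + 3 · 1# + 3 · 1#
        ≤⟨ +-mono-≤ (+-mono-≤ (bound (- c) nonneg⁻ (star u) (proper-star u))
                              (bound (- c) nonneg⁻ (star v) (proper-star v)))
                    (bound c nonneg⁺ ⁅ e ⁆ proper-⁅ e ⁆) ⟩
      sum P + sum Q + sum R
        ≡⟨ trans (cong (_+ sum R) (sym (∑-distrib-+ P Q))) (sym (∑-distrib-+ (λ t → P t + Q t) R)) ⟩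
      sum (λ t → P t + Q t + R t)
        ≡⟨ sum-cong-≗ merged ⟩
      sum (λ t → 1# + 1# when crosses ⁅ e ⁆ (ends t))
        ≡⟨ sum-count (1# + 1#) (crosses ⁅ e ⁆ ∘ ends) ⟩
      count (crosses ⁅ e ⁆ ∘ ends) · (1# + 1#)
        ≡⟨ cong (_· (1# + 1#)) (count-⁅ e ⁆) ⟩
      4 · (1# + 1#) ∎
      where
      open ≤-Reasoning
      scaled = normalise z z≢0
      c = proj₁ scaled
      l₀ = proj₁ (proj₂ (proj₂ scaled))
      b = quotient {k} 6 l₀
      e = remainder {k} 6 l₀
      u = proj₁ (ends e)
      v = proj₂ (ends e)
      bound = λ c nonneg → cut≥3 z z⊥ c nonneg b

      nonneg⁺ : ∀ l → 0# ≤ 1# + c * z l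
      nonneg⁺ l = x*x≤1⇒0≤1+x (proj₁ (proj₂ scaled) l)
      -- The squared bound is unchanged when `c` is negated, so one lemma covers both signs.
      nonneg⁻ : ∀ l → 0# ≤ 1# + - c * z l
      nonneg⁻ l = x*x≤1⇒0≤1+x (subst (_≤ 1#)
        (trans (sym (-x*-x≡x*x (c * z l))) (cong (λ x → x * x) (-‿distribˡ-* c (z l))))
        (proj₁ (proj₂ scaled) l))

      P Q R : Fin 6 → Carrier
      P t = 1# + - c * z (combine {k} b t) when crosses (star u) (ends t)
      Q t = 1# + - c * z (combine {k} b t) when crosses (star v) (ends t)
      R t = 1# + c * z (combine {k} b t) when crosses ⁅ e ⁆ (ends t)

      -- `e` in copy `b` is the edge `l₀`, where the scaled vector equals 1.
      vanishes : 1# + - c * z (combine {k} b e) ≡ 0#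
      vanishes = trans (cong (1# +_) (trans (sym (-‿distribˡ-* c _)) (cong -_
        (trans (cong (λ l → c * z l) (combine-remQuot {k} 6 l₀)) (proj₂ (proj₂ (proj₂ scaled)))))))
        (-‿inverseʳ 1#)

      complementary : ∀ x → (1# + - c * x) + (1# + c * x) ≡ 1# + 1#
      complementary x = trans (solve 3 (λ o m p → o :+ m :+ (o :+ p) := o :+ o :+ (m :+ p)) refl
          1# (- c * x) (c * x))
        (trans (cong (1# + 1# +_) (trans (cong (_+ c * x) (sym (-‿distribˡ-* c x))) (-‿inverseˡ (c * x))))
          (+-identityʳ (1# + 1#)))

      merged : ∀ t → P t + Q t + R t ≡ (1# + 1# when crosses ⁅ e ⁆ (ends t))
      merged t = subst
        (λ r → P t + Q t + (1# + c * z (combine {k} b t) when r) ≡ (1# + 1# when r))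
        (sym (crosses-⁅⁆ e t))
        (merge (crosses (star u) (ends t)) (crosses (star v) (ends t))
          (λ u∈t v∈t → trans (cong (λ t → 1# + - c * z (combine {k} b t))
                             (crossesBoth⇒≡ e t u∈t v∈t)) vanishes)
          (complementary _))

    -- The queries asked on `unit`, restricted to the 6k edges, are the rows of a matrix. With fewer
    -- rows than columns it would have a nonzero kernel vector.
    6k≤cost : k ℕ.* 6 ℕ.≤ cost A unit
    6k≤cost = decidable-stable (k ℕ.* 6 ℕ.≤? cost A unit) λ 6k≰cost →
      let z , z≢0 , z⊥ = underdetermined (ℕ.≰⇒> 6k≰cost) (λ i l → uncurry (queries A unit i) (edge l))
      in orthogonal⇒zero z z⊥ z≢0

-- Transport to n = 3k + 1 vertices.

open import Data.Nat using (_+_; _*_; _∸_; _≤_)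

theorem1p3 : (ℝ : RealField) → (k : ℕ) →
    let n = 3 * k + 1 in
    (A : Graphs.LinAlg ℝ n) → Graphs.ComputesMinCut ℝ A →
    ∃ λ w → Graphs.NonNeg ℝ w × 2 * n ∸ 2 ≤ Graphs.cost ℝ A w
-- The construction lives on `suc (k * 3)` vertices. As this number indexes the types of graphs and
-- algorithms, the whole claim is transported; the hard input is `unit`.
theorem1p3 ℝ k = subst
  (λ n → (A : Graphs.LinAlg ℝ n) → Graphs.ComputesMinCut ℝ A →
    ∃ λ w → Graphs.NonNeg ℝ w × 2 * n ∸ 2 ≤ Graphs.cost ℝ A w)
  (trans (cong suc (ℕ.*-comm k 3)) (ℕ.+-comm 1 (3 * k)))
  λ A correct → unit A correct , unit-nonneg A correct ,
    subst (_≤ Graphs.cost ℝ A (unit A correct)) (sym 2n∸2≡6k) (6k≤cost A correct)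
  where
  open LowerBound ℝ k
  2n∸2≡6k : 2 * suc (k * 3) ∸ 2 ≡ k * 6
  2n∸2≡6k = begin
    2 * suc (k * 3) ∸ 2   ≡⟨ cong (_∸ 2) (ℕ.*-suc 2 (k * 3)) ⟩
    2 * (k * 3)           ≡⟨ ℕ.*-comm 2 (k * 3) ⟩
    k * 3 * 2             ≡⟨ ℕ.*-assoc k 3 2 ⟩
    k * 6                 ∎
    where open ≡-Reasoning
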